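{- Let $M\in\mathrm{pSh}(\Omega,L)$. There is an ordinal $\alpha$ such that for all $n<\omega$ and all $\bar a,\bar b\in{}^n|M|$ with $E\bar a=E\bar b$: if $(M,\bar a)\sim^{E\bar a}_\alpha(M,\bar b)$, then $(M,\bar a)\sim^{E\bar a}_\beta(M,\bar b)$ for all ordinals $\beta$.
   Context: **Presheaves.** Fix a complete Heyting algebra $\Omega$ (top $\top$) and a cardinal $\mu$. A presheaf $M$ over $\Omega$ is a set $|M|$ of sections with maps $E:|M|\to\Omega$ (extent) and $\upharpoonright:|M|\times\Omega\to|M|$ (restriction) such that $a\upharpoonright Ea=a$, $E(a\upharpoonright p)=Ea\wedge p$, $(a\upharpoonright p)\upharpoonright q=a\upharpoonright(p\wedge q)$. Put $[a=b]_M=\bigvee\{p\le Ea\wedge Eb: a\upharpoonright p=b\upharpoonright p\}$; presheaves are extensional: $Ea=Eb=[a=b]_M$ implies $a=b$. For $p\in\Omega$, $|M\upharpoonright p|=\{a\in|M|:Ea\le p\}$. For a tuple $\bar a=\langle a_i:i<\gamma\rangle$ of sections, $E\bar a=\bigwedge_iEa_i$ ($E\emptyset=\top$), $\bar a\upharpoonright p=\langle a_i\upharpoonright p\rangle_i$, $[\bar a=\bar b]_M=\bigwedge_i[a_i=b_i]_M$. **Structures.** A signature has finitary relation symbols, finitary function symbols and a presheaf over $\Omega$ of constant symbols (so each constant $c$ has an extent $Ec$). An element $M$ of $\mathrm{pSh}(\Omega,L)$ is a presheaf with: for each $n$-ary $R$ a map $R^M:|M|^n\to\Omega$ with $R^M(\bar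 a)\le E\bar a$ and $[\bar a=\bar b]_M\wedge R^M(\bar a)\le R^M(\bar b)$; for each $n$-ary $f$ a map $f^M:|M|^n\to|M|$ with $Ef^M(\bar a)=E\bar a$ and $[\bar a=\bar b]_M\le[f^M(\bar a)=f^M(\bar b)]_M$; for each constant $c$ a section $\mathfrak c^M$ with $E\mathfrak c^M=Ec$, compatibly with restriction. **Partial isomorphisms.** For $A\subseteq|M|$, $\langle A\rangle=\{a\upharpoonright p:a\in A,p\in\Omega\}$. A partial isomorphism $h:M\to N$ is a bijection $h:A\to B$, $A\subseteq|M|$, $B\subseteq|N|$, with $[a_0=a_1]_M=[h(a_0)=h(a_1)]_N$ on $A$, such that, extending $h$ to $\langle A\rangle$ by $h(a\upharpoonright p)=h(a)\upharpoonright p$, for all $x,y,x_0,\dots\in\langle A\rangle$: $[x=y]_M=[h(x)=h(y)]_N$; $R^M(x_0,\dots,x_{n-1})=R^N(h(x_0),\dots,h(x_{n-1}))$; $[x=\mathfrak c^M]_M=[h(x)=\mathfrak c^N]_N$; $[f^M(x_0,\dots,x_{n-1})=x_n]_M=[f^N(h(x_0),\dots,h(x_{n-1}))=h(x_n)]_N$, for all relation symbols $R$, constants $c$ and function symbols $f$. Domains, ranges, values and inclusions below refer to the extended maps; $h_q$ is the restriction of $h$ to sections of extent exactly $q$. **$Q_\alpha(p)$.** $Q_0(p)$ is the class of all partial isomorphisms between elements of $\mathrm{pSh}(\Omega,L)$; $Q_\alpha(p)=\bigcap_{\beta<\alpha}Q_\beta(p)$ for limit $\alpha$; $h:M\to N$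 is in $Q_{\beta+1}(p)$ iff $h\in Q_\beta(p)$ and: (Forth) for every nonempty $\bar c=\langle c_i:i<\gamma\rangle$, $\gamma<\mu$, from $|M\upharpoonright p|$ there is a set $\{(h_j,q_j,\bar d_j):j\in J\}$ such that for each $j$: $h_j:M\to N$ is in $Q_\beta(q_j)$, $h_{q_j}\subseteq h_j$, $\bar d_j=\langle d_{ji}:i<\gamma\rangle$ is from $|N\upharpoonright E\bar c|$, $E\bar d_j=q_j$, $c_i\upharpoonright q_j\in\mathrm{dom}(h_j)$ and $h_j(c_i\upharpoonright q_j)=d_{ji}$ for all $i<\gamma$; and $\bigvee_jq_j=E\bar c$; (Back) for every nonempty $\bar d=\langle d_i:i<\gamma\rangle$, $\gamma<\mu$, from $|N\upharpoonright p|$ there is a set $\{(h_j,q_j,\bar c_j):j\in J\}$ such that for each $j$: $h_j\in Q_\beta(q_j)$, $h_{q_j}\subseteq h_j$, $\bar c_j=\langle c_{ji}\rangle$ is from $|M\upharpoonright E\bar d|$, $E\bar c_j=q_j$, $h_j(c_{ji})=d_i\upharpoonright q_j$ for all $i$; and $\bigvee_jq_j=E\bar d$. **$\sim$.** For tuples $\bar a$ from $|M\upharpoonright p|$ and $\bar b$ of the same length from $|N\upharpoonright p|$, $(M,\bar a)\sim^p_\alpha(N,\bar b)$ means that $h$ given by $h(a_i)=b_i$ is a (well-defined) partial isomorphism in $Q_\alpha(p)$. (With $p=E\bar a$ this presupposes that all entries of $\bar a$ have the same extent.) The least $\alpha$ as in the claim is called the Scott rank of $M$. -}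

module Defs where

open import Level using (Level; suc; Lift)
open import Data.Fin using (Fin)
open import Data.Nat using (ℕ)
open import Data.Product using (Σ; ∃-syntax; Σ-syntax; _×_; _,_; proj₁; proj₂)
open import Data.Unit using (⊤)
open import Data.Vec.Functional using (Vector; foldr)
open import Function.Bundles using (_⤖_)
open import Induction.WellFounded using (WellFounded)
open import Relation.Binary.Bundles using (Setoid)
open import Relation.Binary.Core using (Rel; REL)
open import Relation.Binary.Definitions using (Irrelevant)
open import Relation.Binary.Lattice.Bundles using (HeytingAlgebra)
open import Relation.Binary.PropositionalEquality using (_≡_)
open import Relation.Binary.Structures using (IsStrictTotalOrder)
open import Relation.Nullary using (¬_)

-- Throughout, "set" means setoid (or type) in Set ℓ, and ordinals are those
-- of the universe Set ℓ.

------------------------------------------------------------------------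
-- Complete Heyting algebras

record CompleteHeytingAlgebra (ℓ : Level) : Set (suc ℓ) where
  field
    heytingAlgebra : HeytingAlgebra ℓ ℓ ℓ
  open HeytingAlgebra heytingAlgebra public
  field
    ⋁       : {I : Set ℓ} → (I → Carrier) → Carrier
    ⋁-upper : {I : Set ℓ} (f : I → Carrier) (i : I) → f i ≤ ⋁ f
    ⋁-least : {I : Set ℓ} (f : I → Carrier) (x : Carrier) →
              (∀ i → f i ≤ x) → ⋁ f ≤ x

  ⋀ : {I : Set ℓ} → (I → Carrier) → Carrier
  ⋀ {I} f = ⋁ {I = Σ[ x ∈ Carrier ] (∀ i → x ≤ f i)} proj₁

  ⋀ᶠ : ∀ {n} → Vector Carrier n → Carrier
  ⋀ᶠ = foldr _∧_ (HeytingAlgebra.⊤ heytingAlgebra)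

------------------------------------------------------------------------
-- Cardinals as initial ordinals

-- A cardinal μ is a well-ordered set that is not in bijection with any of its
-- proper initial segments. The ordinals γ < μ are its elements, and such a γ,
-- viewed as the set of smaller ordinals, is Below γ. Irrelevance of < ensures
-- that Below γ has one element for each i < γ.
record Cardinal (ℓ : Level) : Set (suc ℓ) where
  infix 4 _<_
  field
    Carrier            : Set ℓ
    _<_                : Rel Carrier ℓ
    isStrictTotalOrder : IsStrictTotalOrder _≡_ _<_
    <-wellFounded      : WellFounded _<_
    <-irrelevant       : Irrelevant _<_

  Below : Carrier → Set ℓ
  Below γ = Σ[ i ∈ Carrier ] (i < γ)

  field
    initial : ∀ γ → ¬ (Carrier ⤖ Below γ)

------------------------------------------------------------------------
-- Ordinals

-- Ordinals are represented by zero, successors and limits of small families.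
-- The last two arguments of olim (the family is inhabited and has no largest
-- member) make olim f a limit ordinal, with f cofinal in it. Several terms may
-- denote the same ordinal, i.e. be ≤ᵒ each other.
infix 4 _≤ᵒ_ _<ᵒ_

data Ord (ℓ : Level) : Set (suc ℓ)
data _≤ᵒ_ {ℓ : Level} : Ord ℓ → Ord ℓ → Set (suc ℓ)

data Ord ℓ where
  ozero : Ord ℓ
  osuc  : Ord ℓ → Ord ℓ
  olim  : (I : Set ℓ) (f : I → Ord ℓ) → I →
          (∀ i → ∃[ j ] (osuc (f i) ≤ᵒ f j)) → Ord ℓ

data _≤ᵒ_ {ℓ} where
  zero≤ : ∀ {α} → ozero ≤ᵒ α
  suc≤  : ∀ {α β} → α ≤ᵒ β → osuc α ≤ᵒ osuc β
  ≤lim  : ∀ {α I f i₀ u} (i : I) → α ≤ᵒ f i → α ≤ᵒ olim I f i₀ u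
  lim≤  : ∀ {α I f i₀ u} → (∀ i → f i ≤ᵒ α) → olim I f i₀ u ≤ᵒ α

_<ᵒ_ : ∀ {ℓ} → Ord ℓ → Ord ℓ → Set (suc ℓ)
α <ᵒ β = osuc α ≤ᵒ β

≤ᵒ-refl : ∀ {ℓ} (α : Ord ℓ) → α ≤ᵒ α
≤ᵒ-refl ozero          = zero≤
≤ᵒ-refl (osuc α)       = suc≤ (≤ᵒ-refl α)
≤ᵒ-refl (olim I f _ _) = lim≤ (λ i → ≤lim i (≤ᵒ-refl (f i)))

------------------------------------------------------------------------
-- Presheaves and structures

record Presheaf {ℓ} (Ω : CompleteHeytingAlgebra ℓ) : Set (suc ℓ) where
  open CompleteHeytingAlgebra Ω using (_≈_; _≤_; _∧_; ⋁; ⋀; ⋀ᶠ)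
    renaming (Carrier to ∣Ω∣)
  infixl 8 _↾_
  field
    sections : Setoid ℓ ℓ
  open Setoid sections public using () renaming (Carrier to Section; _≈_ to _≋_)
  field
    E      : Section → ∣Ω∣
    _↾_    : Section → ∣Ω∣ → Section
    E-cong : ∀ {a b} → a ≋ b → E a ≈ E b
    ↾-cong : ∀ {a b p q} → a ≋ b → p ≈ q → a ↾ p ≋ b ↾ q
    ↾-E    : ∀ a → a ↾ E a ≋ a
    E-↾    : ∀ a p → E (a ↾ p) ≈ E a ∧ p
    ↾-↾    : ∀ a p q → (a ↾ p) ↾ q ≋ a ↾ (p ∧ q)

  ⟦_≐_⟧ : Section → Section → ∣Ω∣
  ⟦ a ≐ b ⟧ =
    ⋁ {I = Σ[ p ∈ ∣Ω∣ ] (p ≤ E a ∧ E b × a ↾ p ≋ b ↾ p)} proj₁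

  field
    extensional : ∀ a b → E a ≈ ⟦ a ≐ b ⟧ → E b ≈ ⟦ a ≐ b ⟧ → a ≋ b

  Eⁿ : ∀ {n} → Vector Section n → ∣Ω∣
  Eⁿ a = ⋀ᶠ (λ i → E (a i))

  ⟦_≐ⁿ_⟧ : ∀ {n} → Vector Section n → Vector Section n → ∣Ω∣
  ⟦ a ≐ⁿ b ⟧ = ⋀ᶠ (λ i → ⟦ a i ≐ b i ⟧)

  E⋀ : {I : Set ℓ} → (I → Section) → ∣Ω∣
  E⋀ a = ⋀ (λ i → E (a i))

record Signature {ℓ} (Ω : CompleteHeytingAlgebra ℓ) : Set (suc ℓ) where
  field
    RelSym   : ℕ → Set ℓ
    FunSym   : ℕ → Set ℓ
    ConstSym : Presheaf Ω

-- Relations and functions respect ≋ automatically, by the axioms relating them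
-- to ⟦_≐ⁿ_⟧; for constants this has to be required.
record Structure {ℓ} {Ω : CompleteHeytingAlgebra ℓ} (L : Signature Ω) :
                 Set (suc ℓ) where
  open CompleteHeytingAlgebra Ω using (_≈_; _≤_; _∧_) renaming (Carrier to ∣Ω∣)
  open Signature L
  private module C = Presheaf ConstSym
  field
    presheaf : Presheaf Ω
  open Presheaf presheaf public
  field
    ⟦_⟧ᴿ    : ∀ {n} → RelSym n → Vector Section n → ∣Ω∣
    ⟦⟧ᴿ-≤E  : ∀ {n} (R : RelSym n) a → ⟦ R ⟧ᴿ a ≤ Eⁿ a
    ⟦⟧ᴿ-≐   : ∀ {n} (R : RelSym n) a b → ⟦ a ≐ⁿ b ⟧ ∧ ⟦ R ⟧ᴿ a ≤ ⟦ R ⟧ᴿ b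
    ⟦_⟧ᶠ    : ∀ {n} → FunSym n → Vector Section n → Section
    ⟦⟧ᶠ-E   : ∀ {n} (f : FunSym n) a → E (⟦ f ⟧ᶠ a) ≈ Eⁿ a
    ⟦⟧ᶠ-≐   : ∀ {n} (f : FunSym n) a b →
              ⟦ a ≐ⁿ b ⟧ ≤ ⟦ ⟦ f ⟧ᶠ a ≐ ⟦ f ⟧ᶠ b ⟧
    ⟦_⟧ᶜ    : C.Section → Section
    ⟦⟧ᶜ-cong : ∀ {c d} → c C.≋ d → ⟦ c ⟧ᶜ ≋ ⟦ d ⟧ᶜ
    ⟦⟧ᶜ-E   : ∀ c → E ⟦ c ⟧ᶜ ≈ C.E c
    ⟦⟧ᶜ-↾   : ∀ c p → ⟦ c C.↾ p ⟧ᶜ ≋ ⟦ c ⟧ᶜ ↾ p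

------------------------------------------------------------------------
-- Partial isomorphisms

module _ {ℓ} {Ω : CompleteHeytingAlgebra ℓ} {L : Signature Ω}
         (M N : Structure L) where
  open CompleteHeytingAlgebra Ω using (_≈_)
  open Signature L
  private
    module M = Structure M
    module N = Structure N

  -- The graph of the extension of h from A to ⟨A⟩, where h : A → B has graph H.
  Extend : REL M.Section N.Section ℓ → REL M.Section N.Section ℓ
  Extend H x y =
    ∃[ a ] ∃[ b ] ∃[ p ] (H a b × x M.≋ a M.↾ p × y N.≋ b N.↾ p)

  -- A bijection h : A → B is represented by its graph H, so that A and B are
  -- the domain and range of H.
  record IsPartialIso (H : REL M.Section N.Section ℓ) : Set ℓ where
    field
      respects   : ∀ {a a′ b b′} → a M.≋ a′ → b N.≋ b′ → H a b → H a′ b′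
      functional : ∀ {a b b′} → H a b → H a b′ → b N.≋ b′
      injective  : ∀ {a a′ b} → H a b → H a′ b → a M.≋ a′
      base-≐     : ∀ {a₀ a₁ b₀ b₁} → H a₀ b₀ → H a₁ b₁ →
                   M.⟦ a₀ ≐ a₁ ⟧ ≈ N.⟦ b₀ ≐ b₁ ⟧
      pres-≐     : ∀ {x x′ y y′} → Extend H x y → Extend H x′ y′ →
                   M.⟦ x ≐ x′ ⟧ ≈ N.⟦ y ≐ y′ ⟧
      pres-rel   : ∀ {n} (R : RelSym n) {x y} →
                   (∀ i → Extend H (x i) (y i)) → M.⟦ R ⟧ᴿ x ≈ N.⟦ R ⟧ᴿ y
      pres-const : ∀ c {x y} → Extend H x y →
                   M.⟦ x ≐ M.⟦ c ⟧ᶜ ⟧ ≈ N.⟦ y ≐ N.⟦ c ⟧ᶜ ⟧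
      pres-fun   : ∀ {n} (f : FunSym n) {x y x′ y′} →
                   (∀ i → Extend H (x i) (y i)) → Extend H x′ y′ →
                   M.⟦ M.⟦ f ⟧ᶠ x ≐ x′ ⟧ ≈ N.⟦ N.⟦ f ⟧ᶠ y ≐ y′ ⟧

  record PartialIso : Set (suc ℓ) where
    constructor mkPartialIso
    field
      graph        : REL M.Section N.Section ℓ
      isPartialIso : IsPartialIso graph

------------------------------------------------------------------------
-- The back-and-forth hierarchy

module BackAndForth {ℓ} {Ω : CompleteHeytingAlgebra ℓ} (μ : Cardinal ℓ)
                    {L : Signature Ω} (M N : Structure L) where
  open CompleteHeytingAlgebra Ω using (_≈_; _≤_; ⋁) renaming (Carrier to ∣Ω∣)
  open Cardinal μ using (Below) renaming (Carrier to ∣μ∣)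
  private
    module M = Structure M
    module N = Structure N

  -- x is in the domain of the extended map h, with value y.
  infix 4 _∋_↦_
  _∋_↦_ : PartialIso M N → M.Section → N.Section → Set ℓ
  h ∋ x ↦ y = Extend M N (PartialIso.graph h) x y

  -- h_q ⊆ k
  RestrictionAt_Of_⊆_ : ∣Ω∣ → PartialIso M N → PartialIso M N → Set ℓ
  RestrictionAt q Of h ⊆ k = ∀ x y → M.E x ≈ q → h ∋ x ↦ y → k ∋ x ↦ y

  -- The parameter Q of Forth and Back is the class Q_β of the previous stage.
  module _ (Q : ∣Ω∣ → PartialIso M N → Set (suc ℓ)) where

    record ForthFamily (h : PartialIso M N) {γ : ∣μ∣}
                       (c : Below γ → M.Section) : Set (suc ℓ) where
      field
        J       : Set ℓ
        iso     : J → PartialIso M N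
        q       : J → ∣Ω∣
        d       : J → Below γ → N.Section
        iso∈Q   : ∀ j → Q (q j) (iso j)
        extends : ∀ j → RestrictionAt q j Of h ⊆ iso j
        d-from  : ∀ j i → N.E (d j i) ≤ M.E⋀ c
        E-d     : ∀ j → N.E⋀ (d j) ≈ q j
        maps    : ∀ j i → iso j ∋ c i M.↾ q j ↦ d j i
        covers  : ⋁ q ≈ M.E⋀ c

    record BackFamily (h : PartialIso M N) {γ : ∣μ∣}
                      (d : Below γ → N.Section) : Set (suc ℓ) where
      field
        J       : Set ℓ
        iso     : J → PartialIso M N
        q       : J → ∣Ω∣
        c       : J → Below γ → M.Section
        iso∈Q   : ∀ j → Q (q j) (iso j)
        extends : ∀ j → RestrictionAt q j Of h ⊆ iso j
        c-from  : ∀ j i → M.E (c j i) ≤ N.E⋀ d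
        E-c     : ∀ j → M.E⋀ (c j) ≈ q j
        maps    : ∀ j i → iso j ∋ c j i ↦ d i N.↾ q j
        covers  : ⋁ q ≈ N.E⋀ d

    Forth : ∣Ω∣ → PartialIso M N → Set (suc ℓ)
    Forth p h = (γ : ∣μ∣) → Below γ → (c : Below γ → M.Section) →
                (∀ i → M.E (c i) ≤ p) → ForthFamily h c

    Back : ∣Ω∣ → PartialIso M N → Set (suc ℓ)
    Back p h = (γ : ∣μ∣) → Below γ → (d : Below γ → N.Section) →
               (∀ i → N.E (d i) ≤ p) → BackFamily h d

  -- At limits the intersection is taken over a cofinal family of smaller
  -- ordinals; Q-lim⇒ and Q-lim⇐ show that this is the intersection over all
  -- smaller ordinals.
  Q : Ord ℓ → ∣Ω∣ → PartialIso M N → Set (suc ℓ)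
  Q ozero          p h = Lift (suc ℓ) ⊤
  Q (osuc β)       p h = Q β p h × Forth (Q β) p h × Back (Q β) p h
  Q (olim I f _ _) p h = ∀ i → Q (f i) p h

  Q-antitone : ∀ {α β} → α ≤ᵒ β → ∀ {p h} → Q β p h → Q α p h
  Q-antitone zero≤      _             = _
  Q-antitone (suc≤ α≤β) (hQ , fo , ba) =
    Q-antitone α≤β hQ ,
    (λ γ i c c≤p → let open ForthFamily (fo γ i c c≤p) in record
      { J = J ; iso = iso ; q = q ; d = d
      ; iso∈Q = λ j → Q-antitone α≤β (iso∈Q j)
      ; extends = extends ; d-from = d-from ; E-d = E-d
      ; maps = maps ; covers = covers }) ,
    (λ γ i d d≤p → let open BackFamily (ba γ i d d≤p) in record
      { J = J ; iso = iso ; q = q ; c = c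
      ; iso∈Q = λ j → Q-antitone α≤β (iso∈Q j)
      ; extends = extends ; c-from = c-from ; E-c = E-c
      ; maps = maps ; covers = covers })
  Q-antitone (≤lim i α≤fi) hQ = Q-antitone α≤fi (hQ i)
  Q-antitone (lim≤ f≤β)    hQ = λ i → Q-antitone (f≤β i) hQ

  Q-lim⇒ : ∀ {I f i₀ u p h} → Q (olim I f i₀ u) p h →
           ∀ β → β <ᵒ olim I f i₀ u → Q β p h
  Q-lim⇒ hQ β β<lim = proj₁ (Q-antitone β<lim hQ)

  Q-lim⇐ : ∀ {I f i₀ u p h} →
           (∀ β → β <ᵒ olim I f i₀ u → Q β p h) → Q (olim I f i₀ u) p h
  Q-lim⇐ {f = f} {u = u} all i =
    let j , fi<fj = u i in all (f i) (≤lim j fi<fj)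

  tupleGraph : ∀ {n} → Vector M.Section n → Vector N.Section n →
               REL M.Section N.Section ℓ
  tupleGraph a b x y = ∃[ i ] (x M.≋ a i × y N.≋ b i)

  -- (M , a) ∼ᵖ_α (N , b)
  record _⊢_∼[_]_ (p : ∣Ω∣) {n} (a : Vector M.Section n) (α : Ord ℓ)
                  (b : Vector N.Section n) : Set (suc ℓ) where
    field
      a-from       : ∀ i → M.E (a i) ≤ p
      b-from       : ∀ i → N.E (b i) ≤ p
      isPartialIso : IsPartialIso M N (tupleGraph a b)
      inQ          : Q α p (mkPartialIso (tupleGraph a b) isPartialIso)

{-# OPTIONS --safe #-}
-- If a ∼ b fails at some ordinal, choose an ordinal at which it fails. The pairs
-- of tuples form a set, so the chosen ordinals have an upper bound α. Since ∼ is
-- antitone in the ordinal, a pair related at α has no ordinal at which it fails.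
module Submission where

open import Level using (Level; suc)
open import Axiom.ExcludedMiddle using (ExcludedMiddle)
open import Data.Maybe using (Maybe; just; nothing; maybe)
open import Data.Nat using (ℕ; zero) renaming (suc to 1+_)
open import Data.Product using (Σ-syntax; ∃-syntax; _×_; _,_; proj₁; proj₂)
open import Data.Vec.Functional using (Vector)
open import Function using (_∘_)
open import Relation.Nullary using (¬_; yes; no; contradiction)
open import Relation.Nullary.Decidable using (decidable-stable)
open import Defs

private variable
  ℓ : Level

infixl 6 _+ᵒ_

_+ᵒ_ : Ord ℓ → ℕ → Ord ℓ
α +ᵒ zero   = α
α +ᵒ (1+ n) = osuc (α +ᵒ n)

-- Adding all natural numbers to the members of the family leaves no largest
-- one, and the index nothing inhabits the family, as olim demands.
upperBound : {S : Set ℓ} (f : S → Ord ℓ) → ∃[ α ] (∀ s → f s ≤ᵒ α)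
upperBound {S = S} f =
  olim (Maybe S × ℕ) g (nothing , 0) (λ (s , n) → (s , 1+ n) , ≤ᵒ-refl _) ,
  λ s → ≤lim (just s , 0) (≤ᵒ-refl (f s))
  where
  g : Maybe S × ℕ → Ord _
  g (s , n) = maybe f ozero s +ᵒ n

-- `S` lies in `Set ℓ`, the level of the index types of `olim`, so one ordinal can bound the stages
-- of all its elements.
antitone⇒stabilizes :
  ExcludedMiddle (suc ℓ) → {S : Set ℓ} (P : Ord ℓ → S → Set (suc ℓ)) →
  (∀ {α β s} → α ≤ᵒ β → P β s → P α s) →
  ∃[ α ] (∀ s → P α s → ∀ β → P β s)
antitone⇒stabilizes em {S} P antitone =
  let α , stage≤α = upperBound (proj₁ ∘ stage) in
  α , λ s Pαs → proj₂ (stage s) (antitone (stage≤α s) Pαs)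
  where
  -- The implication gives every `s` a stage: if `P` fails at `γ`, its premise is refuted there.
  stage : ∀ s → ∃[ γ ] (P γ s → ∀ β → P β s)
  stage s with em {∃[ γ ] (¬ P γ s)}
  ... | yes (γ , ¬Pγs) = γ , λ Pγs → contradiction Pγs ¬Pγs
  ... | no  ¬failure   =
    -- Without a failure any ordinal serves as the stage, and `P β s` follows by double negation
    -- elimination.
    ozero , λ _ β → decidable-stable em (λ ¬Pβs → ¬failure (β , ¬Pβs))

proposition5p11 :
    ∀ {ℓ} → ExcludedMiddle (suc ℓ) →
    (Ω : CompleteHeytingAlgebra ℓ) (μ : Cardinal ℓ) (L : Signature Ω) (M : Structure L) →
    let open CompleteHeytingAlgebra Ω using (_≈_)
        open Structure M using (Section)
        open Structure M using (Eⁿ)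
        open BackAndForth μ M M using (_⊢_∼[_]_) in
    ∃[ α ] (∀ (n : ℕ) (a b : Vector Section n) → Eⁿ a ≈ Eⁿ b →
            Eⁿ a ⊢ a ∼[ α ] b → ∀ (β : Ord ℓ) → Eⁿ a ⊢ a ∼[ β ] b)
proposition5p11 {ℓ} em Ω μ L M =
  let α , stable = antitone⇒stabilizes em {S} P ∼-antitone in
  α , λ n a b _ → stable (n , a , b)
  where
  open Structure M using (Section; Eⁿ)
  open BackAndForth μ M M using (_⊢_∼[_]_; Q-antitone)

  -- Tuples of all lengths are gathered in one type, so that `α` does not depend on `n`.
  S : Set ℓ
  S = Σ[ n ∈ ℕ ] (Vector Section n × Vector Section n)

  P : Ord ℓ → S → Set (suc ℓ)
  P α (n , a , b) = Eⁿ a ⊢ a ∼[ α ] b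

  ∼-antitone : ∀ {α β s} → α ≤ᵒ β → P β s → P α s
  -- Of the four fields, only `inQ` involves the ordinal.
  ∼-antitone α≤β a∼b = record
    { a-from       = a-from
    ; b-from       = b-from
    ; isPartialIso = isPartialIso
    ; inQ          = Q-antitone α≤β inQ
    }
    where open _⊢_∼[_]_ a∼b
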